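{- The cycle index of the $4$-group $S_8^{(4)}$ of the symmetric group $S_8$, i.e. of the action of $S_8$ on the $70$ four-element subsets of $\{1,\dots,8\}$, in the variables $a_1,a_2,\dots$, is \begin{align*} Z(S_8^{(4)}) = \frac{1}{8!} \big(& a_{1}^{70} + 28 a_{1}^{30} a_{2}^{20} + 210 a_{1}^{14} a_{2}^{28} + 112 a_{1}^{10} a_{3}^{20} + 525 a_{1}^{6} a_{2}^{32} \\ & + 1120 a_{1}^{6} a_{2}^{2} a_{3}^{8} a_{6}^{6} + 1120 a_{1}^{4} a_{3}^{22} + 3360 a_{1}^{2} a_{4}^{2} a_{6}^{2} a_{12}^{4} + 4200 a_{1}^{2} a_{2}^{6} a_{4}^{14} \\ & + 1680 a_{1}^{2} a_{2}^{4} a_{3}^{4} a_{6}^{8} + 1260 a_{1}^{2} a_{2}^{2} a_{4}^{16} + 4032 a_{5}^{6} a_{10}^{4} + 2688 a_{5}^{2} a_{15}^{4} \\ & + 1120 a_{2}^{2} a_{3}^{10} a_{6}^{6} + 6720 a_{2}^{2} a_{3}^{2} a_{6}^{10} + 5040 a_{2} a_{4} a_{8}^{8} + 1344 a_{5}^{14} + 5760 a_{7}^{10}\big). \end{align*}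
   Context: For a permutation group $A$ on a finite set, and $\alpha\in A$, let $j_k(\alpha)$ be the number of cycles of length $k$ in the disjoint cycle decomposition of $\alpha$ (fixed points counted as cycles of length $1$). The cycle index of $A$ is the polynomial $Z(A)=\frac{1}{|A|}\sum_{\alpha\in A}\prod_{k} a_k^{j_k(\alpha)}$ in the variables $a_1,a_2,\dots$ with rational coefficients. For $1\le r\le p$, $S_p^{(r)}$ (the $r$-group of $S_p$) is the permutation group on the set of $r$-element subsets of $\{1,\dots,p\}$ formed by the permutations $\alpha'$ induced by $\alpha\in S_p$ via $\alpha'\{i_1,\dots,i_r\}=\{\alpha i_1,\dots,\alpha i_r\}$. -}

module Defs where

open import Data.Bool.Base using (Bool; true; false; if_then_else_)
import Data.Bool.Properties as Bool
open import Data.Empty using (⊥)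
open import Data.Fin.Base using (zero; suc; punchIn)
import Data.Fin.Permutation as Perm
open Perm using (Permutation′; _⟨$⟩ʳ_; _⟨$⟩ˡ_; insert; remove; insert-remove; inverseˡ; inverseʳ; flip)
open import Data.Fin.Properties using (_≟_)
open import Data.Fin.Subset using (Subset; inside; outside; ∣_∣)
open import Data.Integer.Base using (+_)
open import Data.List.Base using (List; []; _∷_; [_]; _++_; map; filter; foldr; length; iterate; upTo; applyUpTo; allFin; replicate; deduplicate; cartesianProductWith)
import Data.List.Membership.DecPropositional as DecMembership
open import Data.List.Membership.Propositional using (_∈_)
open import Data.List.Membership.Propositional.Properties using (∈-map⁺; ∈-map⁻; ∈-++⁺ˡ; ∈-++⁺ʳ; ∈-allFin; ∈-cartesianProductWith⁺)
import Data.List.Membership.Setoid as SetoidMembership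
open import Data.List.Membership.Setoid.Properties using (∈-deduplicate⁺; ∈-deduplicate⁻)
open import Data.List.Relation.Unary.All as All using (All; []; _∷_)
import Data.List.Relation.Unary.AllPairs as AllPairs
open import Data.List.Relation.Unary.Any as Any using (here)
import Data.List.Relation.Unary.Any.Properties as Any
import Data.List.Relation.Unary.Unique.DecSetoid.Properties as UniqueDec
open import Data.List.Relation.Unary.Unique.Propositional using (Unique)
import Data.List.Relation.Unary.Unique.Propositional.Properties as Unique
import Data.List.Relation.Unary.Unique.Setoid as SetoidUnique
import Data.Nat.Base as ℕ
open ℕ using (ℕ; zero; suc; NonZero; _⊔_)
import Data.Nat.Properties as ℕ
open import Data.Product.Base using (_×_; _,_; proj₁; proj₂; ∃; ∃-syntax)
open import Data.Rational.Base as ℚ using (ℚ; 0ℚ; 1ℚ; _/_)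
import Data.Vec.Base as Vec
open Vec using ([]; _∷_; lookup; tabulate)
open import Data.Vec.Properties using (lookup∘tabulate; tabulate∘lookup; tabulate-cong; ≡-dec; ∷-injectiveʳ)
open import Function.Base using (_∘_)
open import Function.Bundles using (_↔_; Inverse; mk↔ₛ′)
open import Function.Construct.Composition using (_↔-∘_)
open import Function.Construct.Identity using (↔-id)
open import Function.Construct.Symmetry using (↔-sym)
open import Level using (0ℓ)
open import Relation.Binary.Bundles using (DecSetoid; Setoid)
open import Relation.Binary.Definitions using (DecidableEquality)
open import Relation.Binary.PropositionalEquality using (_≡_; refl; sym; trans; cong; module ≡-Reasoning)
open import Relation.Nullary.Decidable using (Dec; yes; no; map′)
import Algebra.Properties.CommutativeMonoid.Sum ℕ.+-0-commutativeMonoid as Sum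

------------------------------------------------------------------------
-- Polynomials over ℚ in the variables a 0, a 1, a 2, …

-- e₀ ∷ e₁ ∷ … ∷ eₙ ∷ [] stands for a₀^e₀ a₁^e₁ … aₙ^eₙ.  The list may have
-- trailing zeros, so monomials are compared with _≈ᵐ_ rather than _≡_.
Monomial : Set
Monomial = List ℕ

exponent : Monomial → ℕ → ℕ
exponent []      _       = 0
exponent (e ∷ _) zero    = e
exponent (_ ∷ m) (suc k) = exponent m k

_*ᵐ_ : Monomial → Monomial → Monomial
[]      *ᵐ n       = n
(d ∷ m) *ᵐ []      = d ∷ m
(d ∷ m) *ᵐ (e ∷ n) = (d ℕ.+ e) ∷ (m *ᵐ n)

-- Past the end of both lists all exponents are 0.
_≈ᵐ_ : Monomial → Monomial → Set
m ≈ᵐ n = All (λ k → exponent m k ≡ exponent n k) (upTo (length m ⊔ length n))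

_≈ᵐ?_ : ∀ m n → Dec (m ≈ᵐ n)
m ≈ᵐ? n = All.all? (λ k → exponent m k ℕ.≟ exponent n k) (upTo (length m ⊔ length n))

-- A polynomial is a formal sum of terms; the same monomial may occur in several
-- terms.  Two such sums are the same polynomial when all their collected
-- coefficients agree (_≈_ below).
Polynomial : Set
Polynomial = List (ℚ × Monomial)

coefficient : Polynomial → Monomial → ℚ
coefficient p m = foldr ℚ._+_ 0ℚ (map proj₁ (filter (λ t → proj₂ t ≈ᵐ? m) p))

infix  4 _≈_
infixl 6 _+_
infixl 7 _*_
infixr 7 _·_ _•_
infixr 8 _^_

_≈_ : Polynomial → Polynomial → Set
p ≈ q = ∀ m → coefficient p m ≡ coefficient q m

a : ℕ → Polynomial
a k = [ (1ℚ , replicate k 0 ++ [ 1 ]) ]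

𝟘 𝟙 : Polynomial
𝟘 = []
𝟙 = [ (1ℚ , []) ]

_+_ : Polynomial → Polynomial → Polynomial
_+_ = _++_

_*_ : Polynomial → Polynomial → Polynomial
_*_ = cartesianProductWith (λ (c , m) (d , n) → (c ℚ.* d , m *ᵐ n))

_^_ : Polynomial → ℕ → Polynomial
p ^ zero  = 𝟙
p ^ suc n = p * p ^ n

_•_ : ℚ → Polynomial → Polynomial
c • p = map (λ (d , m) → (c ℚ.* d , m)) p

_·_ : ℕ → Polynomial → Polynomial
n · p = (+ n / 1) • p

∑ ∏ : List Polynomial → Polynomial
∑ = foldr _+_ 𝟘
∏ = foldr _*_ 𝟙

------------------------------------------------------------------------
-- Permutations of a finite set and their cycles

record FiniteSet : Set₁ where
  field
    Carrier  : Set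
    _≟ᶜ_     : DecidableEquality Carrier
    elements : List Carrier
    complete : ∀ x → x ∈ elements
    unique   : Unique elements

  size : ℕ
  size = length elements

module _ (X : FiniteSet) where
  open FiniteSet X
  open DecMembership _≟ᶜ_ using (_∈?_)

  Permutation : Set
  Permutation = Carrier ↔ Carrier

  -- Equality of permutations as functions, ignoring the proofs of bijectivity.
  permutationDecSetoid : DecSetoid 0ℓ 0ℓ
  permutationDecSetoid = record
    { Carrier = Permutation
    ; _≈_     = λ α β → ∀ x → Inverse.to α x ≡ Inverse.to β x
    ; isDecEquivalence = record
      { isEquivalence = record
        { refl  = λ _ → refl
        ; sym   = λ p x → sym (p x)
        ; trans = λ p q x → trans (p x) (q x)
        }
      ; _≟_ = λ α β → map′
          (λ eqs x → All.lookup eqs (complete x))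
          (λ eq → All.universal eq elements)
          (All.all? (λ x → Inverse.to α x ≟ᶜ Inverse.to β x) elements)
      }
    }

  permutationSetoid : Setoid 0ℓ 0ℓ
  permutationSetoid = DecSetoid.setoid permutationDecSetoid

  -- (x, αx, α²x, …, αˡ⁻¹x), where l is the least positive number with αˡx = x;
  -- l is at most the size of the set.
  cycle : Permutation → Carrier → List Carrier
  cycle α x = deduplicate _≟ᶜ_ (iterate (Inverse.to α) x size)

  -- The disjoint cycle decomposition, including the cycles of length 1.  Each
  -- cycle is written starting from the first of its points in elements.
  cycles : Permutation → List (List Carrier)
  cycles α = map (cycle α) (deduplicate (λ x y → y ∈? cycle α x) elements)

  j : ℕ → Permutation → ℕ
  j k α = length (filter (λ c → length c ℕ.≟ k) (cycles α))

  record PermutationGroup : Set where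
    open SetoidMembership permutationSetoid using () renaming (_∈_ to _∈ᵖ_)
    open SetoidUnique permutationSetoid using () renaming (Unique to Uniqueᵖ)
    field
      members    : List Permutation
      distinct   : Uniqueᵖ members
      id-closed  : ↔-id Carrier ∈ᵖ members
      ∘-closed   : ∀ {α β} → α ∈ᵖ members → β ∈ᵖ members → (α ↔-∘ β) ∈ᵖ members
      inv-closed : ∀ {α} → α ∈ᵖ members → ↔-sym α ∈ᵖ members

    order : ℕ
    order = length members

    order≢0 : NonZero order
    order≢0 with members | id-closed
    ... | _ ∷ _ | _ = _

-- Cycles are no longer than the size of the set, so j k α = 0 for all larger k.
Z : {X : FiniteSet} → PermutationGroup X → Polynomial
Z {X} A = (+ 1 / order) {{order≢0}} •
  ∑ (map (λ α → ∏ (map (λ k → a k ^ j X k α) (applyUpTo suc size))) members)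
  where
  open FiniteSet X using (size)
  open PermutationGroup A

------------------------------------------------------------------------
-- The symmetric group, acting on {1, …, p} = Fin p

-- A permutation of {0, …, n} is determined by the image of 0 and a permutation
-- of the remaining n points.
symmetric : ∀ p → List (Permutation′ p)
symmetric zero    = [ Perm.id ]
symmetric (suc n) = cartesianProductWith (insert zero) (allFin (suc n)) (symmetric n)

private
  insert-cong : ∀ {n} k {π ρ : Permutation′ n} → π Perm.≈ ρ →
                insert zero k π Perm.≈ insert zero k ρ
  insert-cong k eq i with zero ≟ i
  ... | yes _ = refl
  ... | no  _ = cong (punchIn k) (eq _)

symmetric-complete : ∀ {p} (α : Permutation′ p) →
                     ∃[ π ] π ∈ symmetric p × α Perm.≈ π
symmetric-complete {zero}  α = Perm.id , here refl , λ ()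
symmetric-complete {suc n} α
  with π , π∈ , eq ← symmetric-complete (remove zero α)
  = insert zero (α ⟨$⟩ʳ zero) π
  , ∈-cartesianProductWith⁺ (insert zero) (∈-allFin (α ⟨$⟩ʳ zero)) π∈
  , λ i → trans (sym (insert-remove zero α i)) (insert-cong (α ⟨$⟩ʳ zero) eq i)

------------------------------------------------------------------------
-- The set of r-element subsets of Fin p

RSubset : ℕ → ℕ → Set
RSubset p r = ∃[ s ] ∣_∣ {p} s ≡ r

RSubset-≡ : ∀ {p r} {s t : RSubset p r} → proj₁ s ≡ proj₁ t → s ≡ t
RSubset-≡ {s = s , refl} {t = .s , q} refl = cong (s ,_) (ℕ.≡-irrelevant refl q)

private
  in∷ : ∀ {p r} → RSubset p r → RSubset (suc p) (suc r)
  in∷ (s , eq) = inside ∷ s , cong suc eq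

  out∷ : ∀ {p r} → RSubset p r → RSubset (suc p) r
  out∷ (s , eq) = outside ∷ s , eq

rSubsets : ∀ p r → List (RSubset p r)
rSubsets zero    zero    = [ ([] , refl) ]
rSubsets zero    (suc r) = []
rSubsets (suc p) zero    = map out∷ (rSubsets p zero)
rSubsets (suc p) (suc r) = map in∷ (rSubsets p r) ++ map out∷ (rSubsets p (suc r))

private
  rSubsets-complete : ∀ {p r} (s : RSubset p r) → s ∈ rSubsets p r
  rSubsets-complete {r = zero}  ([] , refl) = here refl
  rSubsets-complete {r = zero}  (false ∷ s , eq) = ∈-map⁺ out∷ (rSubsets-complete (s , eq))
  rSubsets-complete {suc p} {suc r} (true ∷ s , refl) =
    ∈-++⁺ˡ (∈-map⁺ in∷ (rSubsets-complete (s , refl)))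
  rSubsets-complete {suc p} {suc r} (false ∷ s , eq) =
    ∈-++⁺ʳ (map in∷ (rSubsets p r)) (∈-map⁺ out∷ (rSubsets-complete (s , eq)))

  rSubsets-unique : ∀ p r → Unique (rSubsets p r)
  rSubsets-unique zero    zero    = [] AllPairs.∷ AllPairs.[]
  rSubsets-unique zero    (suc r) = AllPairs.[]
  rSubsets-unique (suc p) zero    =
    Unique.map⁺ (RSubset-≡ ∘ ∷-injectiveʳ ∘ cong proj₁) (rSubsets-unique p zero)
  rSubsets-unique (suc p) (suc r) = Unique.++⁺
    (Unique.map⁺ (RSubset-≡ ∘ ∷-injectiveʳ ∘ cong proj₁) (rSubsets-unique p r))
    (Unique.map⁺ (RSubset-≡ ∘ ∷-injectiveʳ ∘ cong proj₁) (rSubsets-unique p (suc r)))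
    disjoint
    where
    disjoint : ∀ {s} → s ∈ map in∷ (rSubsets p r) × s ∈ map out∷ (rSubsets p (suc r)) → ⊥
    disjoint (s∈ , s∈′) with ∈-map⁻ in∷ s∈ | ∈-map⁻ out∷ s∈′
    ... | _ , _ , refl | _ , _ , ()

RSubsetFinite : ℕ → ℕ → FiniteSet
RSubsetFinite p r = record
  { Carrier  = RSubset p r
  ; _≟ᶜ_     = λ s t → map′ RSubset-≡ (cong proj₁) (≡-dec Bool._≟_ (proj₁ s) (proj₁ t))
  ; elements = rSubsets p r
  ; complete = rSubsets-complete
  ; unique   = rSubsets-unique p r
  }

------------------------------------------------------------------------
-- The r-group of the symmetric group

-- { α i | i ∈ s }, whose characteristic vector at k is that of s at α⁻¹ k.
image : ∀ {p} → Permutation′ p → Subset p → Subset p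
image α s = tabulate (λ k → lookup s (α ⟨$⟩ˡ k))

private
  indicator : Bool → ℕ
  indicator b = if b then 1 else 0

  ∣-∣-sum : ∀ {p} (s : Subset p) → ∣ s ∣ ≡ Sum.sum (indicator ∘ lookup s)
  ∣-∣-sum []          = refl
  ∣-∣-sum (true ∷ s)  = cong suc (∣-∣-sum s)
  ∣-∣-sum (false ∷ s) = ∣-∣-sum s

∣image∣ : ∀ {p} (α : Permutation′ p) s → ∣ image α s ∣ ≡ ∣ s ∣
∣image∣ α s = begin
  ∣ image α s ∣                               ≡⟨ ∣-∣-sum (image α s) ⟩
  Sum.sum (indicator ∘ lookup (image α s))        ≡⟨ Sum.sum-cong-≗ (λ k → cong indicator (lookup∘tabulate (λ k → lookup s (α ⟨$⟩ˡ k)) k)) ⟩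
  Sum.sum (indicator ∘ lookup s ∘ (α ⟨$⟩ˡ_))      ≡⟨ Sum.sum-permute (indicator ∘ lookup s) (flip α) ⟨
  Sum.sum (indicator ∘ lookup s)                  ≡⟨ ∣-∣-sum s ⟨
  ∣ s ∣                                           ∎
  where open ≡-Reasoning

image-cong : ∀ {p} {α β : Permutation′ p} → α Perm.≈ β → ∀ s → image α s ≡ image β s
image-cong {α = α} {β} eq s = tabulate-cong λ k → cong (lookup s) (begin
  α ⟨$⟩ˡ k                        ≡⟨ cong (α ⟨$⟩ˡ_) (inverseʳ β) ⟨
  α ⟨$⟩ˡ (β ⟨$⟩ʳ (β ⟨$⟩ˡ k))      ≡⟨ cong (α ⟨$⟩ˡ_) (eq (β ⟨$⟩ˡ k)) ⟨
  α ⟨$⟩ˡ (α ⟨$⟩ʳ (β ⟨$⟩ˡ k))      ≡⟨ inverseˡ α ⟩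
  β ⟨$⟩ˡ k                        ∎)
  where open ≡-Reasoning

image-id : ∀ {p} (s : Subset p) → image Perm.id s ≡ s
image-id = tabulate∘lookup

image-∘ : ∀ {p} (α β : Permutation′ p) s → image (α ↔-∘ β) s ≡ image α (image β s)
image-∘ α β s = tabulate-cong λ k → sym (lookup∘tabulate _ (α ⟨$⟩ˡ k))

induced : ∀ {p} r → Permutation′ p → Permutation (RSubsetFinite p r)
induced r α = mk↔ₛ′ (act α) (act (flip α))
  (λ (s , _) → RSubset-≡ (cancel α (flip α) (λ _ → inverseʳ α) s))
  (λ (s , _) → RSubset-≡ (cancel (flip α) α (λ _ → inverseˡ α) s))
  where
  act : ∀ {p r} → Permutation′ p → RSubset p r → RSubset p r
  act α (s , eq) = image α s , trans (∣image∣ α s) eq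

  cancel : ∀ {p} (α β : Permutation′ p) → α ↔-∘ β Perm.≈ Perm.id →
           ∀ s → image α (image β s) ≡ s
  cancel α β eq s = trans (sym (image-∘ α β s))
    (trans (image-cong {α = α ↔-∘ β} {β = Perm.id} eq s) (image-id s))

-- Different α may induce the same permutation of the r-element subsets (for
-- example when r = p); as a permutation group the r-group contains it once.
rGroup : ∀ p r → PermutationGroup (RSubsetFinite p r)
rGroup p r = record
  { members    = members
  ; distinct   = UniqueDec.deduplicate-! DS (map (induced r) (symmetric p))
  ; id-closed  = ∈⁺ {↔-id _} Perm.id (λ (s , _) → RSubset-≡ (sym (image-id s)))
  ; ∘-closed   = λ {β} {γ} β∈ γ∈ → ∘-closed {β} {γ} β∈ γ∈
  ; inv-closed = λ {β} β∈ → inv-closed {β} β∈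
  }
  where
  X = RSubsetFinite p r
  DS = permutationDecSetoid X
  open DecSetoid DS using () renaming (_≟_ to _≟ᵖ_; _≈_ to _≈ᵖ_; setoid to S; sym to sym-≈; trans to trans-≈)
  open SetoidMembership S using () renaming (_∈_ to _∈ᵖ_)

  members : List (Permutation X)
  members = deduplicate _≟ᵖ_ (map (induced r) (symmetric p))

  ∈⁺ : ∀ {β} (α : Permutation′ p) → β ≈ᵖ induced r α → β ∈ᵖ members
  ∈⁺ {β} α eq with π , π∈ , α≈π ← symmetric-complete α =
    ∈-deduplicate⁺ S _≟ᵖ_ (λ {x} {y} {z} p q → trans-≈ {x} {y} {z} q (sym-≈ {z} {y} p)) {z = β}
      (Any.map⁺ (Any.map
        (λ { refl t → trans (eq t) (RSubset-≡ (image-cong {α = α} {β = π} α≈π (proj₁ t))) }) π∈))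

  ∈⁻ : ∀ {β} → β ∈ᵖ members → ∃[ α ] β ≈ᵖ induced r α
  ∈⁻ {β} β∈ with π , eq ← Any.satisfied (Any.map⁻ (∈-deduplicate⁻ S _≟ᵖ_ (map (induced r) (symmetric p)) {β} β∈)) = π , eq

  ∘-closed : ∀ {β γ} → β ∈ᵖ members → γ ∈ᵖ members → (β ↔-∘ γ) ∈ᵖ members
  ∘-closed {β} {γ} β∈ γ∈ with α , eq ← ∈⁻ {β} β∈ | α′ , eq′ ← ∈⁻ {γ} γ∈ =
    ∈⁺ {β ↔-∘ γ} (α ↔-∘ α′) λ t →
      trans (cong (Inverse.to β) (eq′ t)) (trans (eq _)
        (RSubset-≡ (sym (image-∘ α α′ (proj₁ t)))))

  inv-closed : ∀ {β} → β ∈ᵖ members → ↔-sym β ∈ᵖ members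
  inv-closed {β} β∈ with α , eq ← ∈⁻ {β} β∈ = ∈⁺ {↔-sym β} (flip α) λ t →
    trans (cong (Inverse.from β) (sym (Inverse.strictlyInverseˡ (induced r α) t)))
      (trans (cong (Inverse.from β) (sym (eq _))) (Inverse.strictlyInverseʳ β _))

{-# OPTIONS --safe #-}

-- The number of k-cycles of a permutation is the number of points with return
-- time k divided by k, and return times are invariant under conjugation.  So a
-- sum over the symmetric group whose summand depends only on cycle lengths can
-- be split by the image of 0: if 0 is fixed the current cycle is closed, and
-- each of the n other images contributes the same amount as the image 1, because
-- conjugation by a permutation fixing 0 moves any of them to 1.  Iterating this
-- turns the 8! summands into 2⁷ weighted products of cycles on consecutive
-- points, which are evaluated and collected by computation.  No two elements of
-- S₈ act alike on the 4-subsets, because 4-subsets separate points; hence the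
-- 4-group has order 8!.
module Submission where

open import Defs
open import Data.Integer.Base using (+_)
open import Data.Nat.Base using (_!)
open import Data.Rational.Base using (_/_)
open import Algebra.Bundles using (CommutativeMonoid)
import Algebra.Properties.CommutativeMonoid.Mult as Mult
import Algebra.Properties.CommutativeSemigroup as CommutativeSemigroupProperties
open import Data.Bool.Base using (true; false)
import Data.Bool.Properties as Bool
open import Data.Fin.Base using (Fin; zero; suc; punchIn; toℕ)
import Data.Fin.Permutation as Perm
import Data.Fin.Properties as Fin
import Data.Integer.Base as ℤ
import Data.Integer.Properties as ℤ
open import Data.List.Base using (List; []; _∷_; [_]; _++_; map; filter; foldr; length; iterate; replicate; upTo; applyUpTo; allFin; concat; deduplicate; tabulate; cartesianProductWith)
import Data.List.Membership.DecPropositional as DecMembership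
open import Data.List.Membership.Propositional using (_∈_; _∉_; find)
open import Data.List.Membership.Propositional.Properties using (∈-map⁺; ∈-map⁻; ∈-filter⁺; ∈-filter⁻; ∈-applyUpTo⁺; ∈-applyUpTo⁻; ∈-concat⁺′; ∈-concat⁻′; ∈-deduplicate⁺; ∈-deduplicate⁻)
open import Data.List.Membership.Propositional.Properties.WithK using (unique∧set⇒bag)
import Data.List.Membership.Setoid as SetoidMembership
import Data.List.Membership.Setoid.Properties as SetoidMembershipₚ
import Data.List.Properties as List
open import Data.List.Relation.Binary.BagAndSetEquality using (∼bag⇒↭)
open import Data.List.Relation.Binary.Disjoint.Propositional using (Disjoint)
open import Data.List.Relation.Binary.Permutation.Propositional using (_↭_)
import Data.List.Relation.Binary.Permutation.Propositional.Properties as ↭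
import Data.List.Relation.Binary.Permutation.Setoid as SetoidPermutation
import Data.List.Relation.Binary.Permutation.Setoid.Properties as SetoidPermutationₚ
open import Data.List.Relation.Unary.All as All using (All; []; _∷_)
import Data.List.Relation.Unary.All.Properties as All
open import Data.List.Relation.Unary.AllPairs as AllPairs using ([]; _∷_)
import Data.List.Relation.Unary.AllPairs.Properties as AllPairs
open import Data.List.Relation.Unary.Any as Any using (here; there)
import Data.List.Relation.Unary.Any.Properties as Any
import Data.List.Relation.Unary.Unique.DecPropositional.Properties as UniqueDec
import Data.List.Relation.Unary.Unique.DecSetoid.Properties as UniqueDecSetoid
open import Data.List.Relation.Unary.Unique.Propositional using (Unique)
import Data.List.Relation.Unary.Unique.Propositional.Properties as Unique
import Data.List.Relation.Unary.Unique.Setoid as SetoidUnique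
import Data.List.Relation.Unary.Unique.Setoid.Properties as SetoidUniqueₚ
open import Data.Nat.Base as ℕ using (ℕ; zero; suc; s≤s)
open import Data.Nat.DivMod using (m≡m%n+[m/n]*n; m%n<n; m*n/n≡m)
open import Data.Nat.GeneralisedArithmetic using () renaming (iterate to power)
import Data.Nat.Properties as ℕ
open import Data.Product.Base using (_×_; _,_; proj₁; proj₂; ∃; map₂)
open import Data.Rational.Base as ℚ using (ℚ; 0ℚ; 1ℚ)
import Data.Rational.Properties as ℚ
open import Data.Rational.Unnormalised.Base as ℚᵘ using (mkℚᵘ)
import Data.Rational.Unnormalised.Properties as ℚᵘ
open import Data.Vec.Base using (lookup)
open import Data.Vec.Properties using (lookup∘tabulate)
open import Function.Bundles using (Inverse; mk⇔)
open import Level using (0ℓ)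
open import Relation.Binary.Bundles using (DecSetoid; Setoid)
open import Relation.Binary.PropositionalEquality using (_≡_; _≢_; refl; sym; trans; cong; cong₂; subst; setoid; module ≡-Reasoning)
open import Relation.Nullary.Decidable using (Dec; yes; no; does; dec-true; from-yes; ¬?; _→-dec_)
open import Relation.Nullary.Negation using (¬_; contradiction)
open import Relation.Unary using (Decidable)
open Perm using (Permutation′; _⟨$⟩ʳ_; _⟨$⟩ˡ_; _∘ₚ_; flip; insert; remove; lift₀)
open CommutativeSemigroupProperties (CommutativeMonoid.commutativeSemigroup ℚ.+-0-commutativeMonoid) using (x∙yz≈y∙xz)

-- Repetition-free lists and iterates of a map.

-- In a repetition-free list each membership has a unique proof, so equality as sets is already
-- equality as bags.
same-elements⇒↭ : ∀ {A : Set} {xs ys : List A} → Unique xs → Unique ys →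
                  (∀ {x} → x ∈ xs → x ∈ ys) → (∀ {x} → x ∈ ys → x ∈ xs) → xs ↭ ys
same-elements⇒↭ xs! ys! ⊆ ⊇ = ∼bag⇒↭ (unique∧set⇒bag xs! ys! (mk⇔ ⊆ ⊇))

length-filter-map : ∀ {A B : Set} {P : B → Set} (P? : Decidable P) (f : A → B) xs →
                    length (filter P? (map f xs)) ≡ length (filter (λ x → P? (f x)) xs)
length-filter-map P? f []       = refl
length-filter-map P? f (x ∷ xs) with does (P? (f x))
... | true  = cong suc (length-filter-map P? f xs)
... | false = length-filter-map P? f xs

module _ {A : Set} (f : A → A) where

  power-+ : ∀ x m n → power f x (m ℕ.+ n) ≡ power f (power f x m) n
  power-+ x zero    n = refl
  power-+ x (suc m) n = power-+ (f x) m n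

  power-* : ∀ {x} d n → power f x d ≡ x → power f x (n ℕ.* d) ≡ x
  power-* d zero    eq = refl
  power-* {x} d (suc n) eq =
    trans (power-+ x d (n ℕ.* d)) (trans (cong (λ y → power f y (n ℕ.* d)) eq) (power-* d n eq))

  power-injective : (∀ {x y} → f x ≡ f y → x ≡ y) → ∀ n {x y} → power f x n ≡ power f y n → x ≡ y
  power-injective inj zero    eq = eq
  power-injective inj (suc n) eq = inj (power-injective inj n eq)

  iterate≡applyUpTo : ∀ x n → iterate f x n ≡ applyUpTo (power f x) n
  iterate≡applyUpTo x zero    = refl
  iterate≡applyUpTo x (suc n) = cong (x ∷_) (iterate≡applyUpTo (f x) n)

-- Cycle lengths as return times

module _ (X : FiniteSet) where
  open FiniteSet X
  open DecMembership _≟ᶜ_ using (_∈?_)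

  -- Counts the steps from y to x; the value is n when x is not reached in fewer.
  -- It branches on does so that evaluation never forces the equality proofs.
  hittingTime : (Carrier → Carrier) → ℕ → Carrier → Carrier → ℕ
  hittingTime f zero    x y = 0
  hittingTime f (suc n) x y with does (x ≟ᶜ y)
  ... | true  = 0
  ... | false = suc (hittingTime f n x (f y))

  -- The search starts at `f x`, so that the trivial return after 0 steps does not count; the outer
  -- `suc` restores the skipped step.
  period : (Carrier → Carrier) → Carrier → ℕ
  period f x = suc (hittingTime f size x (f x))

  periods : (Carrier → Carrier) → List ℕ
  periods f = map (period f) elements

  hittingTime-hits : ∀ f n {d x y} → d ℕ.< n → power f y d ≡ x →
                     power f y (hittingTime f n x y) ≡ x
  hittingTime-hits f (suc n) {d} {x} {y} d<n eq with x ≟ᶜ y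
  ... | yes x≡y = sym x≡y
  hittingTime-hits f (suc n) {zero}  d<n       eq | no x≢y = contradiction (sym eq) x≢y
  hittingTime-hits f (suc n) {suc d} (s≤s d<n) eq | no x≢y = hittingTime-hits f n d<n eq

  hittingTime-first : ∀ f n {e x y} → e ℕ.< hittingTime f n x y → power f y e ≢ x
  hittingTime-first f (suc n) {e} {x} {y} e< eq with x ≟ᶜ y
  hittingTime-first f (suc n) {zero}  e<       eq | no x≢y = x≢y (sym eq)
  hittingTime-first f (suc n) {suc e} (s≤s e<) eq | no _   = hittingTime-first f n e< eq

  -- Being injective, `h` preserves and reflects the equality tests, and it carries the steps of `f`
  -- to those of `g`; the two searches stop together.
  hittingTime-cong : ∀ {f g h : Carrier → Carrier} → (∀ {x y} → h x ≡ h y → x ≡ y) →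
                     (∀ x → h (f x) ≡ g (h x)) →
                     ∀ n x y → hittingTime g n (h x) (h y) ≡ hittingTime f n x y
  hittingTime-cong h-inj comm zero    x y = refl
  hittingTime-cong {f} {g} {h} h-inj comm (suc n) x y with x ≟ᶜ y | h x ≟ᶜ h y
  ... | yes _   | yes _     = refl
  ... | yes x≡y | no  hx≢hy = contradiction (cong h x≡y) hx≢hy
  ... | no  x≢y | yes hx≡hy = contradiction (h-inj hx≡hy) x≢y
  ... | no  _   | no  _     = cong suc
    (trans (cong (hittingTime g n (h x)) (sym (comm y))) (hittingTime-cong h-inj comm n x (f y)))

  to-injective : (α : Permutation X) → ∀ {x y} → Inverse.to α x ≡ Inverse.to α y → x ≡ y
  to-injective α {x} {y} eq = trans (sym (Inverse.strictlyInverseʳ α x))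
    (trans (cong (Inverse.from α) eq) (Inverse.strictlyInverseʳ α y))

  map-elements-↭ : (α : Permutation X) → map (Inverse.to α) elements ↭ elements
  map-elements-↭ α = same-elements⇒↭ (Unique.map⁺ (to-injective α) unique) unique
    (λ _ → complete _)
    (λ {x} _ → subst (_∈ map (Inverse.to α) elements) (Inverse.strictlyInverseˡ α x)
      (∈-map⁺ (Inverse.to α) (complete (Inverse.from α x))))

  -- The point `x` has the same return time under `α` as its image under `γ` has under `β`, and `γ`
  -- merely reorders the elements.
  periods-conjugate : ∀ (α β γ : Permutation X) →
    (∀ x → Inverse.to γ (Inverse.to α x) ≡ Inverse.to β (Inverse.to γ x)) →
    periods (Inverse.to α) ↭ periods (Inverse.to β)
  periods-conjugate α β γ comm = subst (_↭ periods (Inverse.to β))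
    (trans (sym (List.map-∘ elements)) (List.map-cong
      (λ x → cong suc (trans (cong (hittingTime (Inverse.to β) size (Inverse.to γ x)) (sym (comm x)))
        (hittingTime-cong (to-injective γ) comm size x (Inverse.to α x)))) elements))
    (↭.map⁺ (period (Inverse.to β)) (map-elements-↭ γ))

  module _ (α : Permutation X) where
    private f = Inverse.to α

    -- Among the `suc size` iterates from `x` to its `size`-th power two coincide, by the pigeonhole
    -- principle. Cancelling the smaller exponent leaves a return after `suc d` steps, where `suc d`
    -- is the difference of the exponents.
    returns : ∀ x → ∃ λ d → d ℕ.< size × power f (f x) d ≡ x
    returns x with Fin.pigeonhole (ℕ.n<1+n size) (λ i → Any.index (complete (power f x (toℕ i))))
    ... | i , k , i<k , eq = d , d<size , power-injective f (to-injective α) (toℕ i) (begin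
      power f (power f x (suc d)) (toℕ i)   ≡⟨ power-+ f x (suc d) (toℕ i) ⟨
      power f x (suc d ℕ.+ toℕ i)           ≡⟨ cong (power f x) d+i≡k ⟩
      power f x (toℕ k)                     ≡⟨ SetoidMembershipₚ.index-injective (setoid Carrier) (complete _) (complete _) eq ⟨
      power f x (toℕ i)                     ∎)
      where
      open ≡-Reasoning
      d = toℕ k ℕ.∸ suc (toℕ i)
      d+i≡k : suc d ℕ.+ toℕ i ≡ toℕ k
      d+i≡k = trans (sym (ℕ.+-suc d (toℕ i))) (ℕ.m∸n+n≡m i<k)
      d<size : d ℕ.< size
      d<size = ℕ.≤-trans (ℕ.≤-trans (ℕ.m≤m+n (suc d) (toℕ i)) (ℕ.≤-reflexive d+i≡k)) (Fin.toℕ≤pred[n] k)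

    power-period : ∀ x → power f x (period f x) ≡ x
    power-period x with d , d<size , eq ← returns x = hittingTime-hits f size d<size eq

    period≤size : ∀ x → period f x ℕ.≤ size
    period≤size x with d , d<size , eq ← returns x =
      ℕ.≤-trans (s≤s (ℕ.≮⇒≥ (λ d< → hittingTime-first f size d< eq))) d<size

    orbit : Carrier → List Carrier
    orbit x = applyUpTo (power f x) (period f x)

    -- A repetition at exponents `i < k` would, after cancelling `i`, give a return after `k - i`
    -- steps, earlier than the first one.
    orbit-unique : ∀ x → Unique (orbit x)
    orbit-unique x = Unique.applyUpTo⁺₁ (power f x) (period f x) distinct
      where
      distinct : ∀ {i k} → i ℕ.< k → k ℕ.< period f x → power f x i ≢ power f x k
      distinct {i} {k} i<k (s≤s k≤) eq = hittingTime-first f size {y = f x} d<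
        (power-injective f (to-injective α) i (begin
          power f (power f x (suc d)) i   ≡⟨ power-+ f x (suc d) i ⟨
          power f x (suc d ℕ.+ i)         ≡⟨ cong (power f x) d+i≡k ⟩
          power f x k                     ≡⟨ eq ⟨
          power f x i                     ∎))
        where
        open ≡-Reasoning
        d = k ℕ.∸ suc i
        d+i≡k : suc d ℕ.+ i ≡ k
        d+i≡k = trans (sym (ℕ.+-suc d i)) (ℕ.m∸n+n≡m i<k)
        d< : d ℕ.< hittingTime f size x (f x)
        d< = ℕ.≤-trans (ℕ.≤-trans (ℕ.m≤m+n (suc d) i) (ℕ.≤-reflexive d+i≡k)) k≤

    power∈orbit : ∀ x n → power f x n ∈ orbit x
    power∈orbit x n = subst (_∈ orbit x) (sym (begin
      power f x n                                    ≡⟨ cong (power f x) (trans (m≡m%n+[m/n]*n n p) (ℕ.+-comm (n ℕ.% p) _)) ⟩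
      power f x ((n ℕ./ p) ℕ.* p ℕ.+ n ℕ.% p)        ≡⟨ power-+ f x ((n ℕ./ p) ℕ.* p) (n ℕ.% p) ⟩
      power f (power f x ((n ℕ./ p) ℕ.* p)) (n ℕ.% p) ≡⟨ cong (λ y → power f y (n ℕ.% p)) (power-* f p (n ℕ./ p) (power-period x)) ⟩
      power f x (n ℕ.% p)                            ∎))
      (∈-applyUpTo⁺ (power f x) (m%n<n n p))
      where
      open ≡-Reasoning
      p = period f x

    orbit⊆cycle : ∀ {x y} → y ∈ orbit x → y ∈ cycle X α x
    orbit⊆cycle {x} y∈ with i , i< , refl ← ∈-applyUpTo⁻ (power f x) y∈ =
      ∈-deduplicate⁺ _≟ᶜ_ (subst (power f x i ∈_) (sym (iterate≡applyUpTo f x size))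
        (∈-applyUpTo⁺ (power f x) (ℕ.≤-trans i< (period≤size x))))

    power∈cycle : ∀ x n → power f x n ∈ cycle X α x
    power∈cycle x n = orbit⊆cycle (power∈orbit x n)

    ∈cycle⇒power : ∀ {x y} → y ∈ cycle X α x → ∃ λ n → y ≡ power f x n
    ∈cycle⇒power {x} {y} y∈ with i , _ , eq ← ∈-applyUpTo⁻ (power f x)
      (subst (y ∈_) (iterate≡applyUpTo f x size) (∈-deduplicate⁻ _≟ᶜ_ (iterate f x size) y∈)) = i , eq

    cycle-unique : ∀ x → Unique (cycle X α x)
    cycle-unique x = UniqueDec.deduplicate-! _≟ᶜ_ (iterate f x size)

    -- The cycle takes `size` iterates and removes repetitions, the orbit takes `period f x`
    -- iterates and has none; their members are the same.
    length-cycle : ∀ x → length (cycle X α x) ≡ period f x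
    length-cycle x = trans (↭.↭-length (same-elements⇒↭ (cycle-unique x) (orbit-unique x)
      (λ y∈ → let n , eq = ∈cycle⇒power y∈ in subst (_∈ orbit x) (sym eq) (power∈orbit x n)) orbit⊆cycle))
      (List.length-applyUpTo (power f x) (period f x))

    -- This is the relation by which `cycles` selects representatives. As it is an equivalence,
    -- every point is related to some representative and cycles of different representatives are
    -- disjoint.
    sameCycleDecSetoid : DecSetoid 0ℓ 0ℓ
    sameCycleDecSetoid = record
      { Carrier = Carrier
      ; _≈_ = λ x y → y ∈ cycle X α x
      ; isDecEquivalence = record
        { isEquivalence = record
          { refl  = λ {x} → power∈cycle x 0
          ; sym   = symmetric-∈
          ; trans = transitive-∈
          }
        ; _≟_ = λ x y → y ∈? cycle X α x
        }
      }
      where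
      open ≡-Reasoning
      symmetric-∈ : ∀ {x y} → y ∈ cycle X α x → x ∈ cycle X α y
      -- After `n` steps from `x`, a further `n * p - n` steps complete `n` full periods and lead
      -- back to `x`.
      symmetric-∈ {x} y∈ with n , refl ← ∈cycle⇒power y∈ =
        subst (_∈ cycle X α (power f x n)) (begin
          power f (power f x n) (n ℕ.* p ℕ.∸ n) ≡⟨ power-+ f x n (n ℕ.* p ℕ.∸ n) ⟨
          power f x (n ℕ.+ (n ℕ.* p ℕ.∸ n))     ≡⟨ cong (power f x) (ℕ.m+[n∸m]≡n (ℕ.m≤m*n n p)) ⟩
          power f x (n ℕ.* p)                   ≡⟨ power-* f p n (power-period x) ⟩
          x                                     ∎)
          (power∈cycle (power f x n) (n ℕ.* p ℕ.∸ n))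
        where p = period f x
      transitive-∈ : ∀ {x y z} → y ∈ cycle X α x → z ∈ cycle X α y → z ∈ cycle X α x
      transitive-∈ {x} y∈ z∈ with m , refl ← ∈cycle⇒power y∈ | n , refl ← ∈cycle⇒power z∈ =
        subst (_∈ cycle X α x) (power-+ f x m n) (power∈cycle x (m ℕ.+ n))

    private
      module S = DecSetoid sameCycleDecSetoid
      representatives : List Carrier
      representatives = deduplicate S._≟_ elements

    period-cycle : ∀ {x y} → y ∈ cycle X α x → period f y ≡ period f x
    period-cycle {x} {y} y∈ = trans (sym (length-cycle y)) (trans (↭.↭-length
      (same-elements⇒↭ (cycle-unique y) (cycle-unique x) (S.trans y∈) (S.trans (S.sym y∈))))
      (length-cycle x))

    -- The cycles of length k are disjoint and partition the points of period k.
    j-periods : ∀ k → j X k α ℕ.* k ≡ length (filter (ℕ._≟ k) (periods f))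
    j-periods k = begin
      length ofLengthK ℕ.* k                          ≡⟨ length-concat ofLengthK (All.all-filter (λ c → length c ℕ.≟ k) (cycles X α)) ⟨
      length (concat ofLengthK)                       ≡⟨ ↭.↭-length (same-elements⇒↭ concat-unique (Unique.filter⁺ (λ x → period f x ℕ.≟ k) unique) ⊆ ⊇) ⟩
      length (filter (λ x → period f x ℕ.≟ k) elements) ≡⟨ length-filter-map (ℕ._≟ k) (period f) elements ⟨
      length (filter (ℕ._≟ k) (periods f))            ∎
      where
      open ≡-Reasoning
      ofLengthK : List (List Carrier)
      ofLengthK = filter (λ c → length c ℕ.≟ k) (cycles X α)

      length-concat : ∀ (cs : List (List Carrier)) → All (λ c → length c ≡ k) cs → length (concat cs) ≡ length cs ℕ.* k
      length-concat []       []         = refl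
      length-concat (c ∷ cs) (eq ∷ eqs) = trans (List.length-++ c) (cong₂ ℕ._+_ eq (length-concat cs eqs))

      concat-unique : Unique (concat ofLengthK)
      concat-unique = Unique.concat⁺
        (All.filter⁺ _ (All.map⁺ (All.universal cycle-unique representatives)))
        (AllPairs.filter⁺ _ (AllPairs.map⁺ (AllPairs.map disjoint
          (UniqueDecSetoid.deduplicate-! sameCycleDecSetoid elements))))
        where
        disjoint : ∀ {x y} → y ∉ cycle X α x → Disjoint (cycle X α x) (cycle X α y)
        disjoint y∉ (z∈x , z∈y) = y∉ (S.trans z∈x (S.sym z∈y))

      ⊆ : ∀ {x} → x ∈ concat ofLengthK → x ∈ filter (λ x → period f x ℕ.≟ k) elements
      ⊆ {x} x∈ with c , x∈c , c∈ ← ∈-concat⁻′ ofLengthK x∈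
               with c∈′ , length≡k ← ∈-filter⁻ (λ c → length c ℕ.≟ k) {xs = cycles X α} c∈
               with r , _ , refl ← ∈-map⁻ (cycle X α) c∈′ =
        ∈-filter⁺ (λ x → period f x ℕ.≟ k) (complete x)
          (trans (period-cycle x∈c) (trans (sym (length-cycle r)) length≡k))

      ⊇ : ∀ {x} → x ∈ filter (λ x → period f x ℕ.≟ k) elements → x ∈ concat ofLengthK
      ⊇ {x} x∈ with _ , period≡k ← ∈-filter⁻ (λ x → period f x ℕ.≟ k) {xs = elements} x∈
               with r , r∈ , r∈x ← find
                      (SetoidMembershipₚ.∈-deduplicate⁺ S.setoid S._≟_
                        (λ {x} {y} {z} p q → S.trans q (S.sym p)) (Any.map (λ { refl → S.refl }) (complete x))) =
        ∈-concat⁺′ x∈r (∈-filter⁺ (λ c → length c ℕ.≟ k)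
          (∈-map⁺ (cycle X α) r∈) (trans (length-cycle r) (trans (sym (period-cycle x∈r)) period≡k)))
        where
        x∈r : x ∈ cycle X α r
        x∈r = S.sym r∈x

    -- The division expresses the cycle count through return times alone, a form that is both
    -- invariant under conjugation and cheap to evaluate.
    j-period : ∀ k → j X (suc k) α ≡ length (filter (ℕ._≟ suc k) (periods f)) ℕ./ suc k
    j-period k = trans (sym (m*n/n≡m (j X (suc k) α) (suc k))) (cong (ℕ._/ suc k) (j-periods (suc k)))

-- Sums over the symmetric group

module _ {c ℓ} (S : Setoid c ℓ) where
  open Setoid S using () renaming (sym to sym-≈)
  open SetoidMembership S using () renaming (_∈_ to _∈ˢ_)
  open SetoidPermutation S using (↭-prep; ↭-sym; ↭-trans; ↭-reflexive-≋; ↭-refl) renaming (_↭_ to _↭ˢ_)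
  open SetoidUnique S using () renaming (Unique to Uniqueˢ)

  -- Permutations are compared pointwise, which requires a version over a setoid. The head of `xs`
  -- is located in `ys` and moved to the front; uniqueness keeps it out of both tails, so the
  -- induction applies to them.
  same-elements⇒↭ˢ : ∀ {xs ys} → Uniqueˢ xs → Uniqueˢ ys →
                     (∀ {x} → x ∈ˢ xs → x ∈ˢ ys) → (∀ {x} → x ∈ˢ ys → x ∈ˢ xs) → xs ↭ˢ ys
  same-elements⇒↭ˢ {[]} {[]}    _ _ _ _ = ↭-refl
  same-elements⇒↭ˢ {[]} {y ∷ _} _ _ _ ⊇ with () ← ⊇ (here (Setoid.refl S))
  same-elements⇒↭ˢ {x ∷ xs} {ys} (x∉ ∷ xs!) ys! ⊆ ⊇
    with as , bs , w , x≈w , ys≋ ← SetoidMembershipₚ.∈-∃++ S (⊆ (here (Setoid.refl S))) = go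
    where
    ys↭ : ys ↭ˢ x ∷ as ++ bs
    ys↭ = ↭-trans (↭-reflexive-≋ ys≋) (SetoidPermutationₚ.shift S (sym-≈ x≈w) as bs)

    go : x ∷ xs ↭ˢ ys
    go with x∉′ ∷ zs! ← SetoidPermutationₚ.Unique-resp-↭ S ys↭ ys! =
      ↭-trans (↭-prep x (same-elements⇒↭ˢ xs! zs!
        (λ z∈ → drop x∉ z∈ (SetoidPermutationₚ.∈-resp-↭ S ys↭ (⊆ (there z∈))))
        (λ z∈ → drop x∉′ z∈ (⊆′ (there z∈))))) (↭-sym ys↭)
      where
      ⊆′ : ∀ {z} → z ∈ˢ x ∷ as ++ bs → z ∈ˢ x ∷ xs
      ⊆′ z∈ = ⊇ (SetoidPermutationₚ.∈-resp-↭ S (↭-sym ys↭) z∈)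

      drop : ∀ {z us vs} → All (λ y → ¬ Setoid._≈_ S x y) us → z ∈ˢ us → z ∈ˢ x ∷ vs → z ∈ˢ vs
      drop x∉ z∈ (here z≈x) = contradiction
        (SetoidMembershipₚ.∈-resp-≈ S z≈x z∈) (All.All¬⇒¬Any x∉)
      drop x∉ z∈ (there z∈′) = z∈′

permutations : ℕ → Setoid 0ℓ 0ℓ
permutations n = record
  { Carrier = Permutation′ n
  ; _≈_ = Perm._≈_
  ; isEquivalence = record
    { refl  = λ _ → refl
    ; sym   = λ p i → sym (p i)
    ; trans = λ p q i → trans (p i) (q i)
    }
  }

insert-injective : ∀ {n} {k l} {π ρ : Permutation′ n} →
                   insert zero k π Perm.≈ insert zero l ρ → k ≡ l × π Perm.≈ ρ
insert-injective {k = k} eq with refl ← eq zero = refl , λ i → Fin.punchIn-injective k _ _ (eq (suc i))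

symmetric-unique : ∀ n → SetoidUnique.Unique (permutations n) (symmetric n)
symmetric-unique zero    = [] ∷ []
symmetric-unique (suc n) = SetoidUniqueₚ.cartesianProductWith⁺
  (setoid (Fin (suc n))) (permutations n) (permutations (suc n)) (insert zero)
  (λ {k} {l} {π} {ρ} → insert-injective {k = k} {l} {π} {ρ}) (Unique.allFin⁺ (suc n)) (symmetric-unique n)

length-symmetric : ∀ n → length (symmetric n) ≡ n !
length-symmetric zero    = refl
length-symmetric (suc n) = trans (length-cartesianProductWith (allFin (suc n)))
  (cong₂ ℕ._*_ (List.length-tabulate {n = suc n} (λ k → k)) (length-symmetric n))
  where
  length-cartesianProductWith : ∀ ks →
    length (cartesianProductWith (insert zero) ks (symmetric n)) ≡ length ks ℕ.* length (symmetric n)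
  length-cartesianProductWith []       = refl
  length-cartesianProductWith (k ∷ ks) = trans (List.length-++ (map (insert zero k) (symmetric n)))
    (cong₂ ℕ._+_ (List.length-map (insert zero k) (symmetric n)) (length-cartesianProductWith ks))

mapsZeroTo : ∀ {n} → Fin (suc n) → List (Permutation′ (suc n))
mapsZeroTo k = map (insert zero k) (symmetric _)

module _ {n : ℕ} where
  open SetoidMembership (permutations (suc n)) using () renaming (_∈_ to _∈ᵖ_)

  mapsZeroTo-unique : ∀ k → SetoidUnique.Unique (permutations (suc n)) (mapsZeroTo k)
  mapsZeroTo-unique k = SetoidUniqueₚ.map⁺ (permutations n) (permutations (suc n))
    (λ {π} {ρ} eq → proj₂ (insert-injective {k = k} {k} {π} {ρ} eq)) (symmetric-unique n)

  ∈-mapsZeroTo⁺ : ∀ k {α} → α ⟨$⟩ʳ zero ≡ k → α ∈ᵖ mapsZeroTo k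
  ∈-mapsZeroTo⁺ k {α} refl with π , π∈ , eq ← symmetric-complete (remove zero α) =
    Any.map⁺ (Any.map (λ { refl → λ where
      zero    → refl
      (suc i) → trans (Perm.punchIn-permute α zero i) (cong (punchIn (α ⟨$⟩ʳ zero)) (eq i)) }) π∈)

  ∈-mapsZeroTo⁻ : ∀ k {α} → α ∈ᵖ mapsZeroTo k → α ⟨$⟩ʳ zero ≡ k
  ∈-mapsZeroTo⁻ k {α} α∈ with π , eq ← Any.satisfied (Any.map⁻ α∈) = eq zero

-- Conjugation of permutations.

-- Since `_∘ₚ_` applies its left argument first, this is σ π σ⁻¹.
conjugate : ∀ {n} → Permutation′ n → Permutation′ n → Permutation′ n
conjugate σ π = flip σ ∘ₚ π ∘ₚ σ

conjugate-image : ∀ {n} (σ π : Permutation′ n) i → conjugate σ π ⟨$⟩ʳ (σ ⟨$⟩ʳ i) ≡ σ ⟨$⟩ʳ (π ⟨$⟩ʳ i)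
conjugate-image σ π i = cong (λ k → σ ⟨$⟩ʳ (π ⟨$⟩ʳ k)) (Perm.inverseˡ σ)

conjugate-injective : ∀ {n} (σ : Permutation′ n) {π ρ} → conjugate σ π Perm.≈ conjugate σ ρ → π Perm.≈ ρ
conjugate-injective σ {π} {ρ} eq i = trans (sym (Perm.inverseˡ σ)) (trans (cong (σ ⟨$⟩ˡ_) (begin
  σ ⟨$⟩ʳ (π ⟨$⟩ʳ i)                ≡⟨ conjugate-image σ π i ⟨
  conjugate σ π ⟨$⟩ʳ (σ ⟨$⟩ʳ i)    ≡⟨ eq (σ ⟨$⟩ʳ i) ⟩
  conjugate σ ρ ⟨$⟩ʳ (σ ⟨$⟩ʳ i)    ≡⟨ conjugate-image σ ρ i ⟩
  σ ⟨$⟩ʳ (ρ ⟨$⟩ʳ i)                ∎)) (Perm.inverseˡ σ))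
  where open ≡-Reasoning

-- The conjugator is lifted and so fixes 0, the point at which the cycle under construction is
-- attached.
_conjugates_to_ : ∀ {n} → Permutation′ n → Permutation′ (suc n) → Permutation′ (suc n) → Set
σ conjugates π to ρ = ∀ i → lift₀ σ ⟨$⟩ʳ (π ⟨$⟩ʳ i) ≡ ρ ⟨$⟩ʳ (lift₀ σ ⟨$⟩ʳ i)

-- The two side conditions hold for `k` equal to 0 and 1, since `lift₀ (lift₀ σ)` fixes both points.
-- These cases pass invariance down to sums over fewer points.
insert-conjugates : ∀ {n} (σ : Permutation′ n) {π ρ} k →
  (∀ i → lift₀ (lift₀ σ) ⟨$⟩ʳ punchIn k i ≡ punchIn k (lift₀ σ ⟨$⟩ʳ i)) →
  lift₀ (lift₀ σ) ⟨$⟩ʳ k ≡ k →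
  σ conjugates π to ρ →
  lift₀ σ conjugates insert zero k π to insert zero k ρ
insert-conjugates σ k comm fix eq zero    = fix
insert-conjugates σ k comm fix eq (suc i) = trans (comm _) (cong (punchIn k) (eq i))

-- Each entry is a product of cycles on consecutive points, weighted by the number
-- of permutations it accounts for in sum-symmetric; conjugate products may recur.
cycleProducts : ∀ p .{{_ : ℕ.NonZero p}} → List (ℕ × Permutation′ p)
cycleProducts (suc zero)    = [ (1 , insert zero zero Perm.id) ]
cycleProducts (suc (suc n)) =
  map (map₂ (insert zero zero)) (cycleProducts (suc n)) ++
  map (λ (w , π) → suc n ℕ.* w , insert zero (suc zero) π) (cycleProducts (suc n))

-- Sums over the symmetric group with values in a commutative monoid.

module Sums {c ℓ} (M : CommutativeMonoid c ℓ) where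
  open CommutativeMonoid M renaming (Carrier to C; _≈_ to _≈ᴹ_; refl to reflᴹ; sym to symᴹ; trans to transᴹ; setoid to setoidᴹ)
  open Mult M using (×-congʳ; ×-assocˡ; ×-distrib-+) renaming (_×_ to _⊗_)
  open import Relation.Binary.Reasoning.Setoid setoidᴹ

  sum : ∀ {a} {A : Set a} → (A → C) → List A → C
  sum g []       = ε
  sum g (x ∷ xs) = g x ∙ sum g xs

  sum-++ : ∀ {a} {A : Set a} (g : A → C) xs ys → sum g (xs ++ ys) ≈ᴹ sum g xs ∙ sum g ys
  sum-++ g []       ys = symᴹ (identityˡ _)
  sum-++ g (x ∷ xs) ys = transᴹ (∙-congˡ (sum-++ g xs ys)) (symᴹ (assoc _ _ _))

  sum-map : ∀ {a b} {A : Set a} {B : Set b} (g : B → C) (f : A → B) xs →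
            sum g (map f xs) ≡ sum (λ x → g (f x)) xs
  sum-map g f []       = refl
  sum-map g f (x ∷ xs) = cong (g (f x) ∙_) (sum-map g f xs)

  sum-cong : ∀ {a} {A : Set a} {g h : A → C} → (∀ x → g x ≈ᴹ h x) → ∀ xs → sum g xs ≈ᴹ sum h xs
  sum-cong eq []       = reflᴹ
  sum-cong eq (x ∷ xs) = ∙-cong (eq x) (sum-cong eq xs)

  sum-⊗ : ∀ {a} {A : Set a} n (g : A → C) xs → sum (λ x → n ⊗ g x) xs ≈ᴹ n ⊗ sum g xs
  sum-⊗ n g []       = symᴹ (⊗-ε n)
    where
    ⊗-ε : ∀ n → n ⊗ ε ≈ᴹ ε
    ⊗-ε zero    = reflᴹ
    ⊗-ε (suc n) = transᴹ (identityˡ _) (⊗-ε n)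
  sum-⊗ n g (x ∷ xs) = transᴹ (∙-congˡ (sum-⊗ n g xs)) (symᴹ (×-distrib-+ (g x) (sum g xs) n))

  sum-↭ : ∀ {a ℓ′} (S : Setoid a ℓ′) {g : Setoid.Carrier S → C} →
          (∀ {x y} → Setoid._≈_ S x y → g x ≈ᴹ g y) →
          ∀ {xs ys} → SetoidPermutation._↭_ S xs ys → sum g xs ≈ᴹ sum g ys
  sum-↭ S {g} g-cong {xs} {ys} xs↭ys = begin
    sum g xs                ≡⟨ sum-foldr xs ⟩
    foldr _∙_ ε (map g xs)  ≈⟨ SetoidPermutationₚ.foldr-commMonoid setoidᴹ isCommutativeMonoid
                                (SetoidPermutationₚ.map⁺ S setoidᴹ g-cong xs↭ys) ⟩
    foldr _∙_ ε (map g ys)  ≡⟨ sum-foldr ys ⟨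
    sum g ys                ∎
    where
    sum-foldr : ∀ xs → sum g xs ≡ foldr _∙_ ε (map g xs)
    sum-foldr []       = refl
    sum-foldr (x ∷ xs) = cong (g x ∙_) (sum-foldr xs)

  sum-cartesianProductWith : ∀ {a b d} {A : Set a} {B : Set b} {D : Set d} (g : D → C) (f : A → B → D) ys {s} xs →
    All (λ x → sum g (map (f x) ys) ≈ᴹ s) xs → sum g (cartesianProductWith f xs ys) ≈ᴹ length xs ⊗ s
  sum-cartesianProductWith g f ys []       []         = reflᴹ
  sum-cartesianProductWith g f ys (x ∷ xs) (eq ∷ eqs) = transᴹ (sum-++ g (map (f x) ys) _)
    (∙-cong eq (sum-cartesianProductWith g f ys xs eqs))

  Invariant : ∀ {n} → (Permutation′ (suc n) → C) → Set ℓ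
  Invariant g = ∀ σ {π ρ} → σ conjugates π to ρ → g π ≈ᴹ g ρ

  -- Conjugation by σ with σ k = 0 maps the permutations taking 0 to suc k
  -- onto those taking 0 to 1.
  sum-mapsZeroTo : ∀ {n} {g : Permutation′ (suc (suc n)) → C} → Invariant g → ∀ k →
                   sum g (mapsZeroTo (suc k)) ≈ᴹ sum g (mapsZeroTo (suc zero))
  sum-mapsZeroTo {n} {g} inv k = begin
    sum g (mapsZeroTo (suc k))                      ≈⟨ sum-cong (λ α → inv σ {α} {conjugate (lift₀ σ) α} (λ i → sym (conjugate-image (lift₀ σ) α i))) (mapsZeroTo (suc k)) ⟩
    sum (λ α → g (conjugate (lift₀ σ) α)) (mapsZeroTo (suc k))     ≡⟨ sum-map g (conjugate (lift₀ σ)) (mapsZeroTo (suc k)) ⟨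
    sum g (map (conjugate (lift₀ σ)) (mapsZeroTo (suc k)))           ≈⟨ sum-↭ P g-cong conj-↭ ⟩
    sum g (mapsZeroTo (suc zero))                   ∎
    where
    P = permutations (suc (suc n))
    σ = Perm.transpose k zero

    -- The identity conjugates `π` to every pointwise equal `ρ`, so invariance includes respect for
    -- pointwise equality.
    g-cong : ∀ {π ρ} → π Perm.≈ ρ → g π ≈ᴹ g ρ
    g-cong {π} {ρ} eq = inv Perm.id (λ i → trans (Perm.lift₀-id (π ⟨$⟩ʳ i))
      (trans (eq i) (cong (ρ ⟨$⟩ʳ_) (sym (Perm.lift₀-id i)))))

    σk≡0 : σ ⟨$⟩ʳ k ≡ zero
    -- The transposition tests `k ≟ k`, which is stuck for a variable `k`; its inverse at 0 tests
    -- `zero ≟ zero` and computes.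
    σk≡0 rewrite dec-true (k Fin.≟ k) refl = refl

    σ⁻¹0≡k : σ ⟨$⟩ˡ zero ≡ k
    σ⁻¹0≡k = refl

    conj-↭ : SetoidPermutation._↭_ P (map (conjugate (lift₀ σ)) (mapsZeroTo (suc k))) (mapsZeroTo (suc zero))
    conj-↭ = same-elements⇒↭ˢ P
      (SetoidUniqueₚ.map⁺ P P (λ {π} {ρ} → conjugate-injective (lift₀ σ) {π} {ρ}) (mapsZeroTo-unique (suc k)))
      (mapsZeroTo-unique (suc zero))
      (λ {β} β∈ → let α , α∈ , β≈ = SetoidMembershipₚ.∈-map⁻ P P {β} β∈ in
        ∈-mapsZeroTo⁺ (suc zero) {β} (trans (β≈ zero)
          (trans (cong (lift₀ σ ⟨$⟩ʳ_) (∈-mapsZeroTo⁻ (suc k) {α} α∈)) (cong suc σk≡0))))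
      -- The preimage of `β` is its conjugate by the inverse of `lift₀ σ`, which takes 0 to `suc k`.
      (λ {β} β∈ → Any.map⁺ (Any.map
        (λ {α} conj⁻¹β≈α i → trans
          (sym (trans (Perm.inverseʳ (lift₀ σ)) (cong (β ⟨$⟩ʳ_) (Perm.inverseʳ (lift₀ σ)))))
          (cong (lift₀ σ ⟨$⟩ʳ_) (conj⁻¹β≈α (lift₀ σ ⟨$⟩ˡ i))))
        (∈-mapsZeroTo⁺ (suc k) {conjugate (flip (lift₀ σ)) β} (trans (cong (lift₀ σ ⟨$⟩ˡ_) (∈-mapsZeroTo⁻ (suc zero) {β} β∈)) (cong suc σ⁻¹0≡k)))))

  -- Induction on the number of points: `g₀` closes the cycle at 0, while `g₁` splices 0 into the
  -- cycle of the next point, with factor `suc n` for the equivalent images. After a splice only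
  -- conjugators fixing that next point are available, which is why `Invariant` asks for no others.
  sum-symmetric : ∀ n (g : Permutation′ (suc n) → C) → Invariant g →
                  sum g (symmetric (suc n)) ≈ᴹ sum (λ (w , π) → w ⊗ g π) (cycleProducts (suc n))
  sum-symmetric zero    g inv = ∙-congʳ (symᴹ (identityʳ _))
  sum-symmetric (suc n) g inv = begin
    sum g (symmetric (suc (suc n)))
      ≈⟨ sum-++ g (mapsZeroTo zero) _ ⟩
    sum g (mapsZeroTo zero) ∙ sum g (cartesianProductWith (insert zero) (tabulate suc) (symmetric (suc n)))
      ≈⟨ ∙-cong (reflexive (sum-map g (insert zero zero) (symmetric (suc n))))
           (sum-cartesianProductWith g (insert zero) (symmetric (suc n)) (tabulate suc) (All.tabulate⁺ (sum-mapsZeroTo inv))) ⟩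
    sum g₀ (symmetric (suc n)) ∙ (length (tabulate {n = suc n} Fin.suc) ⊗ sum g (mapsZeroTo (suc zero)))
      ≡⟨ cong (λ l → sum g₀ (symmetric (suc n)) ∙ (l ⊗ sum g (mapsZeroTo (suc zero)))) (List.length-tabulate {n = suc n} Fin.suc) ⟩
    sum g₀ (symmetric (suc n)) ∙ (suc n ⊗ sum g (mapsZeroTo (suc zero)))
      ≡⟨ cong (λ s → sum g₀ (symmetric (suc n)) ∙ (suc n ⊗ s)) (sum-map g (insert zero (suc zero)) (symmetric (suc n))) ⟩
    sum g₀ (symmetric (suc n)) ∙ (suc n ⊗ sum g₁ (symmetric (suc n)))
      ≈⟨ ∙-cong (sum-symmetric n g₀ (λ σ {π} {ρ} eq → inv (lift₀ σ) (insert-conjugates σ {π} {ρ} zero (λ _ → refl) refl eq)))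
           (×-congʳ (suc n) (sum-symmetric n g₁ (λ σ {π} {ρ} eq → inv (lift₀ σ) (insert-conjugates σ {π} {ρ} (suc zero) (λ { zero → refl ; (suc _) → refl }) refl eq)))) ⟩
    sum (λ (w , π) → w ⊗ g₀ π) (cycleProducts (suc n)) ∙ (suc n ⊗ sum (λ (w , π) → w ⊗ g₁ π) (cycleProducts (suc n)))
      ≈⟨ ∙-congˡ (sum-⊗ (suc n) _ (cycleProducts (suc n))) ⟨
    sum (λ (w , π) → w ⊗ g₀ π) (cycleProducts (suc n)) ∙ sum (λ (w , π) → suc n ⊗ (w ⊗ g₁ π)) (cycleProducts (suc n))
      ≈⟨ ∙-congˡ (sum-cong (λ (w , π) → ×-assocˡ (g₁ π) (suc n) w) (cycleProducts (suc n))) ⟩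
    sum (λ (w , π) → w ⊗ g₀ π) (cycleProducts (suc n)) ∙ sum (λ (w , π) → (suc n ℕ.* w) ⊗ g₁ π) (cycleProducts (suc n))
      ≡⟨ cong₂ _∙_ (sum-map _ (map₂ (insert zero zero)) (cycleProducts (suc n))) (sum-map _ (λ (w , π) → suc n ℕ.* w , insert zero (suc zero) π) (cycleProducts (suc n))) ⟨
    sum (λ (w , π) → w ⊗ g π) (map (map₂ (insert zero zero)) (cycleProducts (suc n))) ∙ sum (λ (w , π) → w ⊗ g π) (map (λ (w , π) → suc n ℕ.* w , insert zero (suc zero) π) (cycleProducts (suc n)))
      ≈⟨ sum-++ _ (map (map₂ (insert zero zero)) (cycleProducts (suc n))) _ ⟨
    sum (λ (w , π) → w ⊗ g π) (cycleProducts (suc (suc n))) ∎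
    where
    g₀ g₁ : Permutation′ (suc n) → C
    g₀ π = g (insert zero zero π)
    g₁ π = g (insert zero (suc zero) π)

-- The action on r-element subsets

module _ {p r : ℕ} where

  private
    X = RSubsetFinite p r
    S = permutationSetoid X

  periods-induced : ∀ (σ π ρ : Permutation′ p) → (∀ i → σ ⟨$⟩ʳ (π ⟨$⟩ʳ i) ≡ ρ ⟨$⟩ʳ (σ ⟨$⟩ʳ i)) →
                    periods X (Inverse.to (induced r π)) ↭ periods X (Inverse.to (induced r ρ))
  periods-induced σ π ρ eq = periods-conjugate X (induced r π) (induced r ρ) (induced r σ)
    λ (s , _) → RSubset-≡ (begin
      image σ (image π s)      ≡⟨ image-∘ σ π s ⟨
      image (π ∘ₚ σ) s         ≡⟨ image-cong {α = π ∘ₚ σ} {β = σ ∘ₚ ρ} eq s ⟩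
      image (σ ∘ₚ ρ) s         ≡⟨ image-∘ ρ σ s ⟩
      image ρ (image σ s)      ∎)
    where open ≡-Reasoning

  -- Quantifying over the enumerated subsets makes this decidable by evaluation for given `p` and
  -- `r`.
  Separating : Set
  Separating = ∀ i k → All (λ s → lookup (proj₁ s) i ≡ lookup (proj₁ s) k) (rSubsets p r) → i ≡ k

  -- A subset contains `i` exactly when its image under `α` contains the image of `i`. If `α` and
  -- `β` induce the same map, then `i` and β⁻¹ α i lie in the same subsets and hence are equal.
  induced-injective : Separating → ∀ {α β} → Setoid._≈_ S (induced r α) (induced r β) → α Perm.≈ β
  induced-injective separating {α} {β} eq i = begin
    α ⟨$⟩ʳ i                          ≡⟨ Perm.inverseʳ β ⟨
    β ⟨$⟩ʳ (β ⟨$⟩ˡ (α ⟨$⟩ʳ i))         ≡⟨ cong (β ⟨$⟩ʳ_) (separating i (β ⟨$⟩ˡ (α ⟨$⟩ʳ i)) (All.universal agree (rSubsets p r))) ⟨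
    β ⟨$⟩ʳ i                          ∎
    where
    open ≡-Reasoning
    agree : ∀ s → lookup (proj₁ s) i ≡ lookup (proj₁ s) (β ⟨$⟩ˡ (α ⟨$⟩ʳ i))
    agree t@(s , _) = begin
      lookup s i                              ≡⟨ cong (lookup s) (Perm.inverseˡ α) ⟨
      lookup s (α ⟨$⟩ˡ (α ⟨$⟩ʳ i))             ≡⟨ lookup∘tabulate _ (α ⟨$⟩ʳ i) ⟨
      lookup (image α s) (α ⟨$⟩ʳ i)           ≡⟨ cong (λ u → lookup (proj₁ u) (α ⟨$⟩ʳ i)) (eq t) ⟩
      lookup (image β s) (α ⟨$⟩ʳ i)           ≡⟨ lookup∘tabulate _ (α ⟨$⟩ʳ i) ⟩
      lookup s (β ⟨$⟩ˡ (α ⟨$⟩ʳ i))             ∎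

  -- The action is faithful, so the induced permutations are pairwise distinct and deduplication
  -- removes none.
  members-rGroup : Separating → PermutationGroup.members (rGroup p r) ≡ map (induced r) (symmetric p)
  members-rGroup separating = deduplicate-unique (DecSetoid._≟_ (permutationDecSetoid X))
    (SetoidUniqueₚ.map⁺ (permutations p) S (λ {α} {β} → induced-injective separating {α} {β}) (symmetric-unique p))
    where
    deduplicate-unique : ∀ {A : Set} {R : A → A → Set} (R? : ∀ x y → Dec (R x y)) {xs} →
                         AllPairs.AllPairs (λ x y → ¬ R x y) xs → deduplicate R? xs ≡ xs
    deduplicate-unique R? []                   = refl
    deduplicate-unique R? {x ∷ xs} (x∉ ∷ xs!)
      rewrite deduplicate-unique R? xs! = cong (x ∷_) (List.filter-all (λ y → ¬? (R? x y)) x∉)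

fourSubsets-separating : Separating {8} {4}
fourSubsets-separating = from-yes (Fin.all? λ i → Fin.all? λ k →
  All.all? (λ s → lookup (proj₁ s) i Bool.≟ lookup (proj₁ s) k) (rSubsets 8 4) →-dec (i Fin.≟ k))

-- Polynomials

open Sums ℚ.+-0-commutativeMonoid using (sum; sum-map; sum-cong; sum-symmetric)
open Mult ℚ.+-0-commutativeMonoid using (×-homo-+) renaming (_×_ to _⊗_)

-- The value is 1 or 0 according to `n ≈ᵐ m`. With `m` fixed it turns a coefficient into a rational
-- sum, to which the results on sums apply.
indicator : Monomial → Monomial → ℚ
indicator m n = coefficient [ (1ℚ , n) ] m

coefficient-∷ : ∀ c n p m → coefficient ((c , n) ∷ p) m ≡ c ℚ.* indicator m n ℚ.+ coefficient p m
coefficient-∷ c n p m with does (n ≈ᵐ? m)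
... | true  = cong (ℚ._+ coefficient p m) (sym (ℚ.*-identityʳ c))
... | false = sym (trans (cong (ℚ._+ coefficient p m) (ℚ.*-zeroʳ c)) (ℚ.+-identityˡ (coefficient p m)))

coefficient-sum : ∀ p m → coefficient p m ≡ sum (λ (c , n) → c ℚ.* indicator m n) p
coefficient-sum []            m = refl
coefficient-sum ((c , n) ∷ p) m = trans (coefficient-∷ c n p m) (cong (c ℚ.* indicator m n ℚ.+_) (coefficient-sum p m))

coefficient-• : ∀ c p m → coefficient (c • p) m ≡ c ℚ.* coefficient p m
coefficient-• c []            m = sym (ℚ.*-zeroʳ c)
coefficient-• c ((d , n) ∷ p) m = begin
  coefficient (c • ((d , n) ∷ p)) m                           ≡⟨ coefficient-∷ (c ℚ.* d) n (c • p) m ⟩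
  c ℚ.* d ℚ.* indicator m n ℚ.+ coefficient (c • p) m         ≡⟨ cong₂ ℚ._+_ (ℚ.*-assoc c d (indicator m n)) (coefficient-• c p m) ⟩
  c ℚ.* (d ℚ.* indicator m n) ℚ.+ c ℚ.* coefficient p m       ≡⟨ ℚ.*-distribˡ-+ c (d ℚ.* indicator m n) (coefficient p m) ⟨
  c ℚ.* (d ℚ.* indicator m n ℚ.+ coefficient p m)             ≡⟨ cong (c ℚ.*_) (coefficient-∷ d n p m) ⟨
  c ℚ.* coefficient ((d , n) ∷ p) m                           ∎
  where open ≡-Reasoning

_^ᵐ_ : Monomial → ℕ → Monomial
m ^ᵐ zero  = []
m ^ᵐ suc n = m *ᵐ (m ^ᵐ n)

^-monomial : ∀ m n → [ (1ℚ , m) ] ^ n ≡ [ (1ℚ , m ^ᵐ n) ]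
^-monomial m zero    = refl
^-monomial m (suc n) = cong ([ (1ℚ , m) ] *_) (^-monomial m n)

∏-monomial : ∀ {A : Set} (f : A → Polynomial) (g : A → Monomial) → (∀ x → f x ≡ [ (1ℚ , g x) ]) →
             ∀ xs → ∏ (map f xs) ≡ [ (1ℚ , foldr _*ᵐ_ [] (map g xs)) ]
∏-monomial f g eq []       = refl
∏-monomial f g eq (x ∷ xs) = cong₂ _*_ (eq x) (∏-monomial f g eq xs)

-- The monomial with one factor a k for each k entries k of ps.
periodsMonomial : ℕ → List ℕ → Monomial
periodsMonomial n ps = foldr _*ᵐ_ []
  (map (λ k → (replicate (suc k) 0 ++ [ 1 ]) ^ᵐ (length (filter (ℕ._≟ suc k) ps) ℕ./ suc k)) (upTo n))

periodsMonomial-↭ : ∀ n {ps qs} → ps ↭ qs → periodsMonomial n ps ≡ periodsMonomial n qs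
periodsMonomial-↭ n ps↭qs = cong (foldr _*ᵐ_ []) (List.map-cong
  (λ k → cong (λ l → (replicate (suc k) 0 ++ [ 1 ]) ^ᵐ (l ℕ./ suc k)) (↭.↭-length (↭.filter-↭ (ℕ._≟ suc k) ps↭qs)))
  (upTo n))

module _ (X : FiniteSet) where
  open FiniteSet X using (size)

  cycleMonomial : Permutation X → Monomial
  cycleMonomial α = periodsMonomial size (periods X (Inverse.to α))

  -- Every factor is a single term with coefficient 1, so the product is again one, with exponents
  -- given by `j-period`.
  ∏-cycleMonomial : ∀ α → ∏ (map (λ k → a k ^ j X k α) (applyUpTo suc size)) ≡ [ (1ℚ , cycleMonomial α) ]
  ∏-cycleMonomial α = begin
    ∏ (map (λ k → a k ^ j X k α) (applyUpTo suc size))            ≡⟨ cong (λ ks → ∏ (map (λ k → a k ^ j X k α) ks)) (List.map-upTo suc size) ⟨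
    ∏ (map (λ k → a k ^ j X k α) (map suc (upTo size)))           ≡⟨ cong ∏ (List.map-∘ (upTo size)) ⟨
    ∏ (map (λ k → a (suc k) ^ j X (suc k) α) (upTo size))         ≡⟨ ∏-monomial _ _ (λ k → trans (^-monomial (replicate (suc k) 0 ++ [ 1 ]) (j X (suc k) α))
                                                                      (cong (λ e → [ (1ℚ , (replicate (suc k) 0 ++ [ 1 ]) ^ᵐ e) ]) (j-period X α k))) (upTo size) ⟩
    [ (1ℚ , cycleMonomial α) ]                                    ∎
    where open ≡-Reasoning

  coefficient-Z : ∀ (A : PermutationGroup X) {αs} → PermutationGroup.members A ≡ αs →
                  ∀ {N} .{{_ : ℕ.NonZero N}} → length αs ≡ N → ∀ m →
                  coefficient (Z A) m ≡ (+ 1 / N) ℚ.* sum (λ α → indicator m (cycleMonomial α)) αs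
  coefficient-Z A refl refl m = trans (coefficient-• (+ 1 / order) (∑ (map (λ α → ∏ (map (λ k → a k ^ j X k α) (applyUpTo suc size))) members)) m)
    (cong ((+ 1 / order) ℚ.*_) (trans (cong (λ p → coefficient p m) (cong ∑ (List.map-cong ∏-cycleMonomial members)))
      (coefficient-∑ members)))
    where
    open PermutationGroup A
    coefficient-∑ : ∀ αs → coefficient (∑ (map (λ α → [ (1ℚ , cycleMonomial α) ]) αs)) m ≡ sum (λ α → indicator m (cycleMonomial α)) αs
    coefficient-∑ []       = refl
    coefficient-∑ (α ∷ αs) = trans (coefficient-∷ 1ℚ (cycleMonomial α) (∑ (map (λ α → [ (1ℚ , cycleMonomial α) ]) αs)) m)
      (cong₂ ℚ._+_ (ℚ.*-identityˡ (indicator m (cycleMonomial α))) (coefficient-∑ αs))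

-- Collecting like terms

WeightedMonomials : Set
WeightedMonomials = List (ℕ × Monomial)

-- Exponent lists are compared literally. Monomials differing only in trailing zeros would stay in
-- separate terms, which does not affect the sum.
addTerm : ℕ → Monomial → WeightedMonomials → WeightedMonomials
addTerm w m [] = [ (w , m) ]
addTerm w m ((v , n) ∷ ws) with does (List.≡-dec ℕ._≟_ m n)
... | true  = (w ℕ.+ v , n) ∷ ws
... | false = (v , n) ∷ addTerm w m ws

collectInto : WeightedMonomials → WeightedMonomials → WeightedMonomials
collectInto vs []             = vs
collectInto vs ((w , m) ∷ ws) = addTerm w m (collectInto vs ws)

-- As first argument of collectInto this prescribes the order of the collected terms.
zeroWeights : WeightedMonomials → WeightedMonomials
zeroWeights = map (λ (_ , m) → 0 , m)

module _ (h : Monomial → ℚ) where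
  open ≡-Reasoning

  weightedSum : WeightedMonomials → ℚ
  weightedSum = sum (λ (w , m) → w ⊗ h m)

  weightedSum-addTerm : ∀ w m ws → weightedSum (addTerm w m ws) ≡ w ⊗ h m ℚ.+ weightedSum ws
  weightedSum-addTerm w m [] = refl
  weightedSum-addTerm w m ((v , n) ∷ ws) with List.≡-dec ℕ._≟_ m n
  ... | yes refl = trans (cong (ℚ._+ weightedSum ws) (×-homo-+ (h m) w v)) (ℚ.+-assoc (w ⊗ h m) (v ⊗ h m) (weightedSum ws))
  ... | no  _    = begin
    v ⊗ h n ℚ.+ weightedSum (addTerm w m ws)        ≡⟨ cong (v ⊗ h n ℚ.+_) (weightedSum-addTerm w m ws) ⟩
    v ⊗ h n ℚ.+ (w ⊗ h m ℚ.+ weightedSum ws)        ≡⟨ x∙yz≈y∙xz (v ⊗ h n) (w ⊗ h m) (weightedSum ws) ⟩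
    w ⊗ h m ℚ.+ (v ⊗ h n ℚ.+ weightedSum ws)        ∎

  weightedSum-collectInto : ∀ vs ws → weightedSum (collectInto vs ws) ≡ weightedSum ws ℚ.+ weightedSum vs
  weightedSum-collectInto vs []             = sym (ℚ.+-identityˡ (weightedSum vs))
  weightedSum-collectInto vs ((w , m) ∷ ws) = begin
    weightedSum (addTerm w m (collectInto vs ws))         ≡⟨ weightedSum-addTerm w m (collectInto vs ws) ⟩
    w ⊗ h m ℚ.+ weightedSum (collectInto vs ws)           ≡⟨ cong (w ⊗ h m ℚ.+_) (weightedSum-collectInto vs ws) ⟩
    w ⊗ h m ℚ.+ (weightedSum ws ℚ.+ weightedSum vs)       ≡⟨ ℚ.+-assoc (w ⊗ h m) (weightedSum ws) (weightedSum vs) ⟨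
    w ⊗ h m ℚ.+ weightedSum ws ℚ.+ weightedSum vs         ∎

  weightedSum-zeroWeights : ∀ ws → weightedSum (zeroWeights ws) ≡ 0ℚ
  weightedSum-zeroWeights []       = refl
  weightedSum-zeroWeights (_ ∷ ws) = trans (ℚ.+-identityˡ (weightedSum (zeroWeights ws))) (weightedSum-zeroWeights ws)

-- Normalised fractions do not compute for a variable `n`, so both sides are compared as
-- unnormalised fractions.
/1-suc : ∀ n → + suc n / 1 ≡ 1ℚ ℚ.+ + n / 1
/1-suc n = ℚ.toℚᵘ-injective (begin
  ℚ.toℚᵘ (+ suc n / 1)                         ≈⟨ ℚ.toℚᵘ-fromℚᵘ (mkℚᵘ (+ suc n) 0) ⟩
  mkℚᵘ (+ suc n) 0                             ≈⟨ ℚᵘ.*≡* (cong (λ i → (+ 1 ℤ.+ i) ℤ.* + 1) (sym (ℤ.*-identityʳ (+ n)))) ⟩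
  mkℚᵘ (+ 1) 0 ℚᵘ.+ mkℚᵘ (+ n) 0               ≈⟨ ℚᵘ.+-congʳ (mkℚᵘ (+ 1) 0) (ℚ.toℚᵘ-fromℚᵘ (mkℚᵘ (+ n) 0)) ⟨
  ℚ.toℚᵘ 1ℚ ℚᵘ.+ ℚ.toℚᵘ (+ n / 1)              ≈⟨ ℚ.toℚᵘ-homo-+ 1ℚ (+ n / 1) ⟨
  ℚ.toℚᵘ (1ℚ ℚ.+ + n / 1)                      ∎)
  where open import Relation.Binary.Reasoning.Setoid ℚᵘ.≃-setoid

/1-* : ∀ n x → (+ n / 1) ℚ.* x ≡ n ⊗ x
/1-* zero    x = ℚ.*-zeroˡ x
/1-* (suc n) x = begin
  (+ suc n / 1) ℚ.* x              ≡⟨ cong (ℚ._* x) (/1-suc n) ⟩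
  (1ℚ ℚ.+ + n / 1) ℚ.* x           ≡⟨ ℚ.*-distribʳ-+ x 1ℚ (+ n / 1) ⟩
  1ℚ ℚ.* x ℚ.+ (+ n / 1) ℚ.* x     ≡⟨ cong₂ ℚ._+_ (ℚ.*-identityˡ x) (/1-* n x) ⟩
  x ℚ.+ n ⊗ x                      ∎
  where open ≡-Reasoning

polynomial : WeightedMonomials → Polynomial
polynomial = map (λ (w , m) → (+ w / 1) , m)

coefficient-polynomial : ∀ ws m → coefficient (polynomial ws) m ≡ weightedSum (indicator m) ws
coefficient-polynomial ws m = begin
  coefficient (polynomial ws) m                             ≡⟨ coefficient-sum (polynomial ws) m ⟩
  sum (λ (c , n) → c ℚ.* indicator m n) (polynomial ws)     ≡⟨ sum-map _ (λ (w , n) → (+ w / 1) , n) ws ⟩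
  sum (λ (w , n) → (+ w / 1) ℚ.* indicator m n) ws          ≡⟨ sum-cong (λ (w , n) → /1-* w (indicator m n)) ws ⟩
  weightedSum (indicator m) ws                              ∎
  where open ≡-Reasoning

-- The cycle index of the r-group as a finite computation.

orbitTerms : ∀ p r .{{_ : ℕ.NonZero p}} → WeightedMonomials
orbitTerms p r = map (map₂ (λ π → cycleMonomial (RSubsetFinite p r) (induced r π))) (cycleProducts p)

-- The argument `ts` is the claimed answer. The sum over the whole group is transformed
-- symbolically; what must be evaluated is confined to the separation property and the two equations
-- about `ts`.
Z-rGroup : ∀ p r .{{_ : ℕ.NonZero p}} .{{_ : ℕ.NonZero (p !)}} → Separating {p} {r} →
           ∀ ts → collectInto (zeroWeights ts) (orbitTerms p r) ≡ ts →
           ∀ {q} → q ≡ polynomial ts → Z (rGroup p r) ≈ (+ 1 / (p !)) • q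
Z-rGroup (suc n) r separating ts collects {q} expands m = begin
  coefficient (Z (rGroup (suc n) r)) m
    ≡⟨ coefficient-Z X (rGroup (suc n) r) (members-rGroup separating) 
         (trans (List.length-map (induced r) (symmetric (suc n))) (length-symmetric (suc n))) m ⟩
  c ℚ.* sum (λ α → indicator m (cycleMonomial X α)) (map (induced r) (symmetric (suc n)))
    ≡⟨ cong (c ℚ.*_) (sum-map (λ α → indicator m (cycleMonomial X α)) (induced r) (symmetric (suc n))) ⟩
  c ℚ.* sum (λ π → indicator m (monomial π)) (symmetric (suc n))
    ≡⟨ cong (c ℚ.*_) (sum-symmetric n (λ π → indicator m (monomial π)) (λ σ {π} {ρ} eq →
         cong (indicator m) (periodsMonomial-↭ (FiniteSet.size X) (periods-induced {r = r} (lift₀ σ) π ρ eq)))) ⟩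
  c ℚ.* sum (λ (w , π) → w ⊗ indicator m (monomial π)) (cycleProducts (suc n))
    ≡⟨ cong (c ℚ.*_) (sum-map (λ (w , μ) → w ⊗ indicator m μ) (map₂ monomial) (cycleProducts (suc n))) ⟨
  c ℚ.* weightedSum (indicator m) terms
    -- The 0 makes room for the zero-weight terms that seed the collection.
    ≡⟨ cong (c ℚ.*_) (ℚ.+-identityʳ (weightedSum (indicator m) terms)) ⟨
  c ℚ.* (weightedSum (indicator m) terms ℚ.+ 0ℚ)
    ≡⟨ cong (λ x → c ℚ.* (weightedSum (indicator m) terms ℚ.+ x)) (weightedSum-zeroWeights (indicator m) ts) ⟨
  c ℚ.* (weightedSum (indicator m) terms ℚ.+ weightedSum (indicator m) (zeroWeights ts))
    ≡⟨ cong (c ℚ.*_) (weightedSum-collectInto (indicator m) (zeroWeights ts) terms) ⟨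
  c ℚ.* weightedSum (indicator m) (collectInto (zeroWeights ts) terms)
    ≡⟨ cong (λ ws → c ℚ.* weightedSum (indicator m) ws) collects ⟩
  c ℚ.* weightedSum (indicator m) ts
    ≡⟨ cong (c ℚ.*_) (coefficient-polynomial ts m) ⟨
  c ℚ.* coefficient (polynomial ts) m
    ≡⟨ cong (λ q′ → c ℚ.* coefficient q′ m) expands ⟨
  c ℚ.* coefficient q m
    ≡⟨ coefficient-• c q m ⟨
  coefficient (c • q) m ∎
  where
  open ≡-Reasoning
  X = RSubsetFinite (suc n) r
  c = (+ 1 / (suc n !)) 
  monomial : Permutation′ (suc n) → Monomial
  monomial π = cycleMonomial X (induced r π)
  terms : WeightedMonomials
  terms = orbitTerms (suc n) r

-- The 4-subsets of eight points.

-- The leading 0 is the exponent of `a 0`. The 22 cycle types of S₈ give only 18 monomials: 525 =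
-- 105 + 420, 4200 = 420 + 1260 + 2520 and 6720 = 3360 + 3360 each merge several types.
cycleTerms : WeightedMonomials
cycleTerms =
  (1 , 0 ∷ 70 ∷ []) ∷
  (28 , 0 ∷ 30 ∷ 20 ∷ []) ∷
  (210 , 0 ∷ 14 ∷ 28 ∷ []) ∷
  (112 , 0 ∷ 10 ∷ 0 ∷ 20 ∷ []) ∷
  (525 , 0 ∷ 6 ∷ 32 ∷ []) ∷
  (1120 , 0 ∷ 6 ∷ 2 ∷ 8 ∷ 0 ∷ 0 ∷ 6 ∷ []) ∷
  (1120 , 0 ∷ 4 ∷ 0 ∷ 22 ∷ []) ∷
  (3360 , 0 ∷ 2 ∷ 0 ∷ 0 ∷ 2 ∷ 0 ∷ 2 ∷ 0 ∷ 0 ∷ 0 ∷ 0 ∷ 0 ∷ 4 ∷ []) ∷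
  (4200 , 0 ∷ 2 ∷ 6 ∷ 0 ∷ 14 ∷ []) ∷
  (1680 , 0 ∷ 2 ∷ 4 ∷ 4 ∷ 0 ∷ 0 ∷ 8 ∷ []) ∷
  (1260 , 0 ∷ 2 ∷ 2 ∷ 0 ∷ 16 ∷ []) ∷
  (4032 , 0 ∷ 0 ∷ 0 ∷ 0 ∷ 0 ∷ 6 ∷ 0 ∷ 0 ∷ 0 ∷ 0 ∷ 4 ∷ []) ∷
  (2688 , 0 ∷ 0 ∷ 0 ∷ 0 ∷ 0 ∷ 2 ∷ 0 ∷ 0 ∷ 0 ∷ 0 ∷ 0 ∷ 0 ∷ 0 ∷ 0 ∷ 0 ∷ 4 ∷ []) ∷
  (1120 , 0 ∷ 0 ∷ 2 ∷ 10 ∷ 0 ∷ 0 ∷ 6 ∷ []) ∷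
  (6720 , 0 ∷ 0 ∷ 2 ∷ 2 ∷ 0 ∷ 0 ∷ 10 ∷ []) ∷
  (5040 , 0 ∷ 0 ∷ 1 ∷ 0 ∷ 1 ∷ 0 ∷ 0 ∷ 0 ∷ 8 ∷ []) ∷
  (1344 , 0 ∷ 0 ∷ 0 ∷ 0 ∷ 0 ∷ 14 ∷ []) ∷
  (5760 , 0 ∷ 0 ∷ 0 ∷ 0 ∷ 0 ∷ 0 ∷ 0 ∷ 10 ∷ []) ∷
  []

-- Sums are concatenations and every summand is a single term, so the two lists of terms agree
-- literally.
expansion :
    ( a 1 ^ 70
    + 28 · (a 1 ^ 30 * a 2 ^ 20)
    + 210 · (a 1 ^ 14 * a 2 ^ 28)
    + 112 · (a 1 ^ 10 * a 3 ^ 20)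
    + 525 · (a 1 ^ 6 * a 2 ^ 32)
    + 1120 · (a 1 ^ 6 * a 2 ^ 2 * a 3 ^ 8 * a 6 ^ 6)
    + 1120 · (a 1 ^ 4 * a 3 ^ 22)
    + 3360 · (a 1 ^ 2 * a 4 ^ 2 * a 6 ^ 2 * a 12 ^ 4)
    + 4200 · (a 1 ^ 2 * a 2 ^ 6 * a 4 ^ 14)
    + 1680 · (a 1 ^ 2 * a 2 ^ 4 * a 3 ^ 4 * a 6 ^ 8)
    + 1260 · (a 1 ^ 2 * a 2 ^ 2 * a 4 ^ 16)
    + 4032 · (a 5 ^ 6 * a 10 ^ 4)
    + 2688 · (a 5 ^ 2 * a 15 ^ 4)
    + 1120 · (a 2 ^ 2 * a 3 ^ 10 * a 6 ^ 6)
    + 6720 · (a 2 ^ 2 * a 3 ^ 2 * a 6 ^ 10)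
    + 5040 · (a 2 * a 4 * a 8 ^ 8)
    + 1344 · (a 5 ^ 14)
    + 5760 · (a 7 ^ 10)
    ) ≡ polynomial cycleTerms
expansion = refl

-- Evaluation computes the return times of the 70 subsets under each of the 128 cycle products;
-- seeding with `zeroWeights cycleTerms` makes the collected terms appear in the stated order.
collected : collectInto (zeroWeights cycleTerms) (orbitTerms 8 4) ≡ cycleTerms
collected = refl

mainTheorem6 : Z (rGroup 8 4) ≈ (+ 1 / (8 !)) •
    ( a 1 ^ 70
    + 28 · (a 1 ^ 30 * a 2 ^ 20)
    + 210 · (a 1 ^ 14 * a 2 ^ 28)
    + 112 · (a 1 ^ 10 * a 3 ^ 20)
    + 525 · (a 1 ^ 6 * a 2 ^ 32)
    + 1120 · (a 1 ^ 6 * a 2 ^ 2 * a 3 ^ 8 * a 6 ^ 6)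
    + 1120 · (a 1 ^ 4 * a 3 ^ 22)
    + 3360 · (a 1 ^ 2 * a 4 ^ 2 * a 6 ^ 2 * a 12 ^ 4)
    + 4200 · (a 1 ^ 2 * a 2 ^ 6 * a 4 ^ 14)
    + 1680 · (a 1 ^ 2 * a 2 ^ 4 * a 3 ^ 4 * a 6 ^ 8)
    + 1260 · (a 1 ^ 2 * a 2 ^ 2 * a 4 ^ 16)
    + 4032 · (a 5 ^ 6 * a 10 ^ 4)
    + 2688 · (a 5 ^ 2 * a 15 ^ 4)
    + 1120 · (a 2 ^ 2 * a 3 ^ 10 * a 6 ^ 6)
    + 6720 · (a 2 ^ 2 * a 3 ^ 2 * a 6 ^ 10)
    + 5040 · (a 2 * a 4 * a 8 ^ 8)
    + 1344 · (a 5 ^ 14)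
    + 5760 · (a 7 ^ 10)
    )
mainTheorem6 = Z-rGroup 8 4 fourSubsets-separating cycleTerms collected expansion
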